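{- Let $\mathcal G=(V,\to,\Omega,\mathcal P)$ be a parity game and let $\mathcal G_q=(V_{/\equiv_d},\to',\Omega',\mathcal P')$ be its direct simulation equivalence quotient. Then $\mathcal G_q\equiv_d\mathcal G$.
   Context: A parity game is a tuple $(V,\to,\Omega,\mathcal P)$ where $V$ is a finite set of vertices, $\to\subseteq V\times V$ is total (every vertex has at least one successor), $\Omega:V\to\mathbb N$ is a priority function, and $\mathcal P:V\to\{\Diamond,\Box\}$ assigns each vertex to player even ($\Diamond$) or odd ($\Box$). Write $V_\Diamond,V_\Box$ for the vertices owned by each player and $v^\bullet=\{w\mid v\to w\}$. One-step forcing: for $v\in V$, $T\subseteq V$ and a player $i$, $v\to_i T$ means: either $\mathcal P(v)=i$ and $v^\bullet\cap T\neq\emptyset$, or $\mathcal P(v)\neq i$ and $v^\bullet\subseteq T$. For $R\subseteq V\times V$ put $vR=\{w\mid v\,R\,w\}$ and $UR=\bigcup_{u\in U}uR$. $R\subseteq V\times V$ is a direct simulation iff $v\,R\,w$ implies: (1) $\Omega(v)=\Omega(w)$; (2) if $v\in V_\Diamond$ then for each $v'\in v^\bullet$, $w\to_\Diamond v'R$; (3) if $v\in V_\Box$ then $w\to_\Diamond v^\bullet R$. Write $v\leq_d w$ iff some direct simulation $R$ has $v\,R\,w$ (this is a preorder), and $v\equiv_d w$ iff $v\leq_d w$ and $w\leq_d v$. Write $[v]_{\equiv_d}$ for the class of $v$, $V_{/\equiv_d}$ for the set of classes, and $[V']_{\equiv_d}=\{[v]_{\equiv_d}\mid v\in V'\}$ for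 $V'\subseteq V$. $\min_{\leq_d}(v)$ is the set of $v'\in v^\bullet$ that are minimal among $v^\bullet$, i.e. for all $u\in v^\bullet$, $u\leq_d v'$ implies $v'\leq_d u$. $\max_{\leq_d}(v)$ is the set of $v'\in v^\bullet$ that are maximal among $v^\bullet$, i.e. for all $u\in v^\bullet$, $v'\leq_d u$ implies $u\leq_d v'$. Direct simulation equivalence quotient of $(V,\to,\Omega,\mathcal P)$: the structure $(V_{/\equiv_d},\to',\Omega',\mathcal P')$ with, for classes $\mathcal C,\mathcal C'$: - $\Omega'(\mathcal C)=\min\{\Omega(v)\mid v\in\mathcal C\}$; - $\mathcal P'(\mathcal C)=\Box$ if $\mathcal C\subseteq V_\Box$ and $|[\min_{\leq_d}(u)]_{\equiv_d}|>1$ for all $u\in\mathcal C$; $\mathcal P'(\mathcal C)=\Diamond$ otherwise; - $\mathcal C\to'\mathcal C'$ iff: in case $\mathcal C\subseteq V_\Box$, for all $v\in\mathcal C$ there is $v'\in\min_{\leq_d}(v)$ with $v'\in\mathcal C'$; in the other case, for all $v\in\mathcal C\cap V_\Diamond$ there is $v'\in\max_{\leq_d}(v)$ with $v'\in\mathcal C'$. Equivalence of games: for parity games $\mathcal G_1,\mathcal G_2$ with vertex sets $V_1,V_2$ and a vertex equivalence $\sim$, $\mathcal G_1\sim\mathcal G_2$ iff in the disjoint union of $\mathcal G_1$ and $\mathcal G_2$, every $v_1\in V_1$ has some $v_2\in V_2$ with $v_1\sim v_2$, and every $v_2\in V_2$ has some $v_1\in V_1$ with $v_1\sim v_2$. 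-}

module Defs where

open import Level using (Level; 0ℓ) renaming (suc to lsuc)
open import Data.Bool.Base using (if_then_else_)
open import Data.Nat.Base using (ℕ; _<_; zero)
import Data.Nat.Properties as ℕₚ
open import Data.Nat.Induction using (Acc; acc; <-wellFounded)
open import Data.List.Base using (List; []; _∷_; map; filter; length; deduplicate; _++_; cartesianProduct)
import Data.List.Properties as Listₚ
open import Data.List.Extrema.Nat using (min)
open import Data.List.Membership.Propositional using (_∈_; find; lose)
open import Data.List.Membership.Propositional.Properties
  using (∈-map⁺; ∈-map⁻; ∈-filter⁺; ∈-filter⁻; ∈-++⁺ˡ; ∈-++⁺ʳ; ∈-cartesianProduct⁺)
import Data.List.Membership.DecPropositional as DecMembership
open import Data.List.Relation.Unary.Any using (here; there)
import Data.List.Relation.Unary.Any as Any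
open import Data.List.Relation.Unary.All using (All)
import Data.List.Relation.Unary.All as All
open import Data.List.Relation.Unary.All.Properties using (¬All⇒Any¬)
open import Data.Product.Base using (∃; ∃-syntax; _×_; _,_; proj₁; proj₂; swap)
import Data.Product.Properties as Productₚ
open import Data.Sum.Base using (_⊎_; inj₁; inj₂; [_,_]′; map₂)
import Data.Sum.Properties as Sumₚ
open import Data.Sum.Relation.Binary.Pointwise using (Pointwise; inj₁; inj₂; ⊎-decidable)
open import Function.Base using (_∘_; flip)
open import Relation.Binary.Core using (Rel)
open import Relation.Binary.Definitions using (Decidable; DecidableEquality; Reflexive; Transitive)
open import Relation.Binary.PropositionalEquality using (_≡_; _≢_; refl; sym; trans; cong; subst)
open import Relation.Nullary.Negation using (¬_; contradiction)
open import Relation.Nullary.Decidable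
  using (Dec; yes; no; does; ¬?; _×-dec_; _⊎-dec_; _→-dec_; map′; recompute)
open import Relation.Unary using (Pred; _⊆_; _≬_)
import Relation.Unary as U

data Player : Set where
  ◇ □ : Player

_≟ₚ_ : DecidableEquality Player
◇ ≟ₚ ◇ = yes refl
◇ ≟ₚ □ = no λ ()
□ ≟ₚ ◇ = no λ ()
□ ≟ₚ □ = yes refl

-- Finiteness of the vertex set is a complete enumeration together with
-- decidable equality.  The edge relation, a subset of a finite set, is
-- decidable.
record ParityGame : Set₁ where
  infix 4 _⟶_ _⟶?_ _≟_
  field
    V        : Set
    _≟_      : DecidableEquality V
    vertices : List V
    complete : ∀ v → v ∈ vertices
    _⟶_      : Rel V 0ℓ
    _⟶?_     : Decidable _⟶_
    total    : ∀ v → ∃[ w ] v ⟶ w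
    Ω        : V → ℕ
    owner    : V → Player

  infix 30 _•

  _• : V → Pred V 0ℓ
  v • = v ⟶_

  successors : V → List V
  successors v = filter (v ⟶?_) vertices

  ∈-successors⁺ : ∀ {v w} → v ⟶ w → w ∈ successors v
  ∈-successors⁺ {v} {w} = ∈-filter⁺ (v ⟶?_) (complete w)

  ∈-successors⁻ : ∀ {v w} → w ∈ successors v → v ⟶ w
  ∈-successors⁻ {v} = proj₂ ∘ ∈-filter⁻ (v ⟶?_) {xs = vertices}

  ∀? : ∀ {p} {P : Pred V p} → U.Decidable P → Dec (∀ v → P v)
  ∀? P? = map′ (λ ps v → All.lookup ps (complete v)) (λ f → All.tabulate λ {v} _ → f v)
               (All.all? P? vertices)

  ∃? : ∀ {p} {P : Pred V p} → U.Decidable P → Dec (∃ P)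
  ∃? P? = map′ Any.satisfied (λ (v , p) → lose (complete v) p) (Any.any? P? vertices)

module Simulation (G : ParityGame) where
  open ParityGame G

  infix 4 _⟶[_]_ _≤ᵈ_ _≡ᵈ_ _≤ᵈ?_ _≡ᵈ?_

  _⟶[_]_ : ∀ {ℓ} → V → Player → Pred V ℓ → Set ℓ
  v ⟶[ i ] T = (owner v ≡ i × (v • ≬ T)) ⊎ (owner v ≢ i × (v • ⊆ T))

  _⟨_⟩ : ∀ {ℓ} → Pred V ℓ → Rel V ℓ → Pred V ℓ
  (U ⟨ R ⟩) w = ∃[ u ] (U u × R u w)

  record Transfer (R : Rel V 0ℓ) (v w : V) : Set where
    constructor transfer
    field
      priority : Ω v ≡ Ω w
      even     : owner v ≡ ◇ → ∀ v′ → v ⟶ v′ → w ⟶[ ◇ ] R v′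
      odd      : owner v ≡ □ → w ⟶[ ◇ ] (v • ⟨ R ⟩)

  IsDirectSimulation : Rel V 0ℓ → Set
  IsDirectSimulation R = ∀ {v w} → R v w → Transfer R v w

  _≤ᵈ_ : Rel V (lsuc 0ℓ)
  v ≤ᵈ w = ∃[ R ] (IsDirectSimulation R × R v w)

  _≡ᵈ_ : Rel V (lsuc 0ℓ)
  v ≡ᵈ w = v ≤ᵈ w × w ≤ᵈ v

  forces-mono : ∀ {ℓ₁ ℓ₂} {T : Pred V ℓ₁} {U : Pred V ℓ₂} {v i} →
                T ⊆ U → v ⟶[ i ] T → v ⟶[ i ] U
  forces-mono T⊆U (inj₁ (eq , v′ , v→v′ , t)) = inj₁ (eq , v′ , v→v′ , T⊆U t)
  forces-mono T⊆U (inj₂ (neq , sub))          = inj₂ (neq , λ v→v′ → T⊆U (sub v→v′))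

  transfer-mono : ∀ {R S : Rel V 0ℓ} → (∀ {v w} → R v w → S v w) →
                  ∀ {v w} → Transfer R v w → Transfer S v w
  transfer-mono R⊆S (transfer p e o) = transfer p
    (λ eq v′ v→v′ → forces-mono R⊆S (e eq v′ v→v′))
    (λ eq → forces-mono (λ (u , v→u , r) → u , v→u , R⊆S r) (o eq))

  forces-◇-◇ : ∀ {ℓ} {T : Pred V ℓ} {v} → owner v ≡ ◇ → v ⟶[ ◇ ] T → v • ≬ T
  forces-◇-◇ eq (inj₁ (_ , meet))  = meet
  forces-◇-◇ eq (inj₂ (neq , _)) = contradiction eq neq

  forces-◇-□ : ∀ {ℓ} {T : Pred V ℓ} {v} → owner v ≡ □ → v ⟶[ ◇ ] T → v • ⊆ T
  forces-◇-□ eq (inj₁ (eq′ , _)) with () ← trans (sym eq) eq′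
  forces-◇-□ eq (inj₂ (_ , sub)) = sub

  forces-transfer : ∀ {ℓ} {T : Pred V ℓ} {S : Rel V 0ℓ} {u w} → Transfer S u w →
                    u ⟶[ ◇ ] T → w ⟶[ ◇ ] (λ y → ∃[ x ] (T x × S x y))
  forces-transfer {u = u} (transfer _ e o) f with owner u in eq
  forces-transfer (transfer _ e o) (inj₁ (_ , u′ , u→u′ , t)) | ◇ =
    forces-mono (λ s → u′ , t , s) (e refl u′ u→u′)
  forces-transfer (transfer _ e o) (inj₂ (neq , _)) | ◇ = contradiction refl neq
  forces-transfer (transfer _ e o) (inj₂ (_ , sub)) | □ =
    forces-mono (λ (x , u→x , s) → x , sub u→x , s) (o refl)

  ≤ᵈ-refl : Reflexive _≤ᵈ_
  ≤ᵈ-refl = _≡_ , (λ { refl → reflTransfer _ }) , refl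
    where
    reflTransfer : ∀ v → Transfer _≡_ v v
    reflTransfer v = transfer refl
      (λ eq v′ v→v′ → inj₁ (eq , v′ , v→v′ , refl))
      (λ eq → inj₂ ((λ eq′ → contradiction (trans (sym eq) eq′) λ ()) ,
                    λ {x} v→x → x , v→x , refl))

  ≤ᵈ-trans : Transitive _≤ᵈ_
  ≤ᵈ-trans (R , simR , r) (S , simS , s) = RS , sim , (_ , r , s)
    where
    RS : Rel V 0ℓ
    RS v w = ∃[ u ] (R v u × S u w)

    sim : IsDirectSimulation RS
    sim (u , r , s) = transfer
      (trans (Transfer.priority (simR r)) (Transfer.priority (simS s)))
      (λ eq v′ v→v′ → forces-transfer (simS s) (Transfer.even (simR r) eq v′ v→v′))
      (λ eq → forces-mono (λ (x , (v′ , v→v′ , r′) , s′) → v′ , v→v′ , x , r′ , s′)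
                (forces-transfer (simS s) (Transfer.odd (simR r) eq)))

  ≡ᵈ-refl : Reflexive _≡ᵈ_
  ≡ᵈ-refl = ≤ᵈ-refl , ≤ᵈ-refl

  ≡ᵈ-trans : Transitive _≡ᵈ_
  ≡ᵈ-trans (a , b) (c , d) = ≤ᵈ-trans a c , ≤ᵈ-trans d b

  -- Decidability: the full relation is refined, by discarding pairs violating
  -- the transfer conditions, down to the largest direct simulation.

  forces? : ∀ {ℓ} {T : Pred V ℓ} → U.Decidable T → ∀ v i → Dec (v ⟶[ i ] T)
  forces? T? v i =
    ((owner v ≟ₚ i) ×-dec ∃? (λ w → (v ⟶? w) ×-dec T? w)) ⊎-dec
    (¬? (owner v ≟ₚ i) ×-dec
      map′ (λ f {w} → f w) (λ f w → f {w}) (∀? (λ w → (v ⟶? w) →-dec T? w)))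

  transfer? : ∀ {R : Rel V 0ℓ} → Decidable R → Decidable (Transfer R)
  transfer? R? v w = map′ (λ (p , e , o) → transfer p e o) (λ (transfer p e o) → p , e , o)
    ((Ω v ℕₚ.≟ Ω w) ×-dec
     ((owner v ≟ₚ ◇) →-dec ∀? (λ v′ → (v ⟶? v′) →-dec forces? (R? v′) w ◇)) ×-dec
     ((owner v ≟ₚ □) →-dec
       forces? (λ y → ∃? (λ u → (v ⟶? u) ×-dec R? u y)) w ◇))

  open DecMembership (Productₚ.≡-dec _≟_ _≟_) using (_∈?_)

  ⟦_⟧ : List (V × V) → Rel V 0ℓ
  ⟦ L ⟧ v w = (v , w) ∈ L

  ContainsSimulations : List (V × V) → Set₁
  ContainsSimulations L = ∀ {R} → IsDirectSimulation R → ∀ {v w} → R v w → ⟦ L ⟧ v w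

  refine : ∀ L → Acc _<_ (length L) → ContainsSimulations L →
           ∃[ L′ ] (IsDirectSimulation ⟦ L′ ⟧ × ContainsSimulations L′)
  refine L (acc rec) above = go (All.all? ok? L)
    where
    ok? : U.Decidable (λ ((v , w) : V × V) → Transfer ⟦ L ⟧ v w)
    ok? (v , w) = transfer? (λ x y → (x , y) ∈? L) v w

    go : Dec (All (λ (v , w) → Transfer ⟦ L ⟧ v w) L) →
         ∃[ L′ ] (IsDirectSimulation ⟦ L′ ⟧ × ContainsSimulations L′)
    go (yes ok)  = L , (λ r → All.lookup ok r) , above
    go (no ¬ok) = refine (filter ok? L)
      (rec (Listₚ.filter-notAll ok? L (¬All⇒Any¬ ok? L ¬ok)))
      (λ sim r → ∈-filter⁺ ok? (above sim r) (transfer-mono (above sim) (sim r)))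

  opaque
    _≤ᵈ?_ : Decidable _≤ᵈ_
    v ≤ᵈ? w = decide (refine (cartesianProduct vertices vertices) (<-wellFounded _)
                             (λ _ _ → ∈-cartesianProduct⁺ (complete _) (complete _)))
      where
      decide : ∃[ L ] (IsDirectSimulation ⟦ L ⟧ × ContainsSimulations L) → Dec (v ≤ᵈ w)
      decide (L , sim , above) =
        map′ (λ r → ⟦ L ⟧ , sim , r) (λ (_ , simR , r) → above simR r) ((v , w) ∈? L)

  _≡ᵈ?_ : Decidable _≡ᵈ_
  v ≡ᵈ? w = (v ≤ᵈ? w) ×-dec (w ≤ᵈ? v)

  IsMinimal : V → Pred V (lsuc 0ℓ)
  IsMinimal v v′ = ∀ u → v ⟶ u → u ≤ᵈ v′ → v′ ≤ᵈ u

  IsMaximal : V → Pred V (lsuc 0ℓ)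
  IsMaximal v v′ = ∀ u → v ⟶ u → v′ ≤ᵈ u → u ≤ᵈ v′

  isMinimal? : ∀ v → U.Decidable (IsMinimal v)
  isMinimal? v v′ = ∀? λ u → (v ⟶? u) →-dec (u ≤ᵈ? v′) →-dec (v′ ≤ᵈ? u)

  isMaximal? : ∀ v → U.Decidable (IsMaximal v)
  isMaximal? v v′ = ∀? λ u → (v ⟶? u) →-dec (v′ ≤ᵈ? u) →-dec (u ≤ᵈ? v′)

  -- Lists rather than predicates, so that membership is small and the number
  -- of classes can be counted.

  min≤ᵈ : V → List V
  min≤ᵈ v = filter (isMinimal? v) (successors v)

  max≤ᵈ : V → List V
  max≤ᵈ v = filter (isMaximal? v) (successors v)

  ∈-min⁺ : ∀ {v v′} → v ⟶ v′ → IsMinimal v v′ → v′ ∈ min≤ᵈ v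
  ∈-min⁺ {v} v→v′ = ∈-filter⁺ (isMinimal? v) (∈-successors⁺ v→v′)

  ∈-min⁻ : ∀ {v v′} → v′ ∈ min≤ᵈ v → v ⟶ v′ × IsMinimal v v′
  ∈-min⁻ {v} v′∈ =
    let (s , m) = ∈-filter⁻ (isMinimal? v) {xs = successors v} v′∈ in ∈-successors⁻ s , m

  ∈-max⁺ : ∀ {v v′} → v ⟶ v′ → IsMaximal v v′ → v′ ∈ max≤ᵈ v
  ∈-max⁺ {v} v→v′ = ∈-filter⁺ (isMaximal? v) (∈-successors⁺ v→v′)

  ∈-max⁻ : ∀ {v v′} → v′ ∈ max≤ᵈ v → v ⟶ v′ × IsMaximal v v′
  ∈-max⁻ {v} v′∈ =
    let (s , m) = ∈-filter⁻ (isMaximal? v) {xs = successors v} v′∈ in ∈-successors⁻ s , m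

extremal : ∀ {a ℓ} {A : Set a} {_≼_ : Rel A ℓ} → Reflexive _≼_ → Transitive _≼_ → Decidable _≼_ →
           ∀ (xs : List A) {x} → x ∈ xs → ∃[ m ] (m ∈ xs × m ≼ x × (∀ u → u ∈ xs → u ≼ m → m ≼ u))
extremal {A = A} {_≼_} ≼-refl ≼-trans _≼?_ xs₀ {x} x∈xs₀ with scan xs₀
  where
  scan : ∀ (xs : List A) → ∃[ m ] ((m ≡ x ⊎ m ∈ xs) × m ≼ x × (∀ u → u ∈ xs → u ≼ m → m ≼ u))
  scan []       = x , inj₁ refl , ≼-refl , λ _ ()
  scan (y ∷ ys) with scan ys
  ... | m , m∈ , m≼x , mini with y ≼? m
  ...   | yes y≼m = y , inj₂ (here refl) , ≼-trans y≼m m≼x , λ where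
            u (here refl) u≼y → ≼-refl
            u (there u∈)  u≼y → ≼-trans y≼m (mini u u∈ (≼-trans u≼y y≼m))
  ...   | no  y⋠m = m , map₂ there m∈ , m≼x , λ where
            u (here refl) u≼m → contradiction u≼m y⋠m
            u (there u∈)  u≼m → mini u u∈ u≼m
... | m , inj₁ refl , rest = m , x∈xs₀ , rest
... | m , inj₂ m∈   , rest = m , m∈ , rest

module Classes (G : ParityGame) where
  open ParityGame G
  open Simulation G

  classMembers : V → List V
  classMembers v = filter (_≡ᵈ? v) vertices

  -- A class is the list of its members in the order of the enumeration, so
  -- propositional equality of classes is equality as subsets of V.
  record Class : Set where
    constructor mkClass
    field
      members  : List V
      .isClass : members ∈ map classMembers vertices

  open Class public

  infix 4 _∈ᶜ_ _≟ᶜ_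

  _∈ᶜ_ : V → Class → Set
  v ∈ᶜ C = v ∈ members C

  [_] : V → Class
  [ v ] = mkClass (classMembers v) (∈-map⁺ classMembers (complete v))

  members-injective : ∀ {C D : Class} → members C ≡ members D → C ≡ D
  members-injective refl = refl

  _≟ᶜ_ : DecidableEquality Class
  C ≟ᶜ D = map′ members-injective (cong members) (Listₚ.≡-dec _≟_ (members C) (members D))

  representative : ∀ C → ∃[ v ] C ≡ [ v ]
  representative (mkClass ms isClass) =
    let open DecMembership (Listₚ.≡-dec _≟_) using (_∈?_)
        (v , _ , eq) = ∈-map⁻ classMembers (recompute (ms ∈? map classMembers vertices) isClass)
    in v , members-injective eq

  ∈-class⁺ : ∀ {u v} → u ≡ᵈ v → u ∈ᶜ [ v ]
  ∈-class⁺ {u} {v} = ∈-filter⁺ (_≡ᵈ? v) (complete u)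

  ∈-class⁻ : ∀ {u v} → u ∈ᶜ [ v ] → u ≡ᵈ v
  ∈-class⁻ {v = v} = proj₂ ∘ ∈-filter⁻ (_≡ᵈ? v) {xs = vertices}

  classes : List Class
  classes = map [_] vertices

  classes-complete : ∀ C → C ∈ classes
  classes-complete C with representative C
  ... | v , refl = ∈-map⁺ [_] (complete v)

  numberOfClasses : List V → ℕ
  numberOfClasses vs = length (deduplicate _≟ᶜ_ (map [_] vs))

-- Only used on non-empty lists.
minimum : List ℕ → ℕ
minimum []       = zero
minimum (n ∷ ns) = min n ns

module Quotient (G : ParityGame) where
  open ParityGame G
  open Simulation G
  open Classes G

  All□ : Class → Set
  All□ C = All (λ v → owner v ≡ □) (members C)

  all□? : U.Decidable All□
  all□? C = All.all? (λ v → owner v ≟ₚ □) (members C)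

  Branching : Class → Set
  Branching C = All (λ u → 1 < numberOfClasses (min≤ᵈ u)) (members C)

  branching? : U.Decidable Branching
  branching? C = All.all? (λ u → 1 ℕₚ.<? numberOfClasses (min≤ᵈ u)) (members C)

  Ω′ : Class → ℕ
  Ω′ C = minimum (map Ω (members C))

  owner′ : Class → Player
  owner′ C = if does (all□? C ×-dec branching? C) then □ else ◇

  MinEdge : Rel Class 0ℓ
  MinEdge C C′ = ∀ v → v ∈ᶜ C → ∃[ v′ ] (v′ ∈ min≤ᵈ v × v′ ∈ᶜ C′)

  MaxEdge : Rel Class 0ℓ
  MaxEdge C C′ = ∀ v → v ∈ᶜ C → owner v ≡ ◇ → ∃[ v′ ] (v′ ∈ max≤ᵈ v × v′ ∈ᶜ C′)

  infix 4 _⟶′_ _⟶′?_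

  _⟶′_ : Rel Class 0ℓ
  C ⟶′ C′ = (All□ C × MinEdge C C′) ⊎ (¬ All□ C × MaxEdge C C′)

  _⟶′?_ : Decidable _⟶′_
  C ⟶′? C′ =
    (all□? C ×-dec
      ∀? (λ v → (v ∈? members C) →-dec
        ∃? (λ v′ → (v′ ∈? min≤ᵈ v) ×-dec (v′ ∈? members C′)))) ⊎-dec
    (¬? (all□? C) ×-dec
      ∀? (λ v → (v ∈? members C) →-dec (owner v ≟ₚ ◇) →-dec
        ∃? (λ v′ → (v′ ∈? max≤ᵈ v) ×-dec (v′ ∈? members C′))))
    where open DecMembership _≟_ using (_∈?_)

  minimal-below : ∀ {v x} → v ⟶ x → ∃[ m ] (m ∈ min≤ᵈ v × m ≤ᵈ x)
  minimal-below {v} v→x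
    with extremal {_≼_ = _≤ᵈ_} ≤ᵈ-refl ≤ᵈ-trans _≤ᵈ?_ (successors v) (∈-successors⁺ v→x)
  ... | m , m∈ , m≤x , mini =
    m , ∈-min⁺ (∈-successors⁻ m∈) (λ u v→u → mini u (∈-successors⁺ v→u)) , m≤x

  maximal-above : ∀ {v x} → v ⟶ x → ∃[ m ] (m ∈ max≤ᵈ v × x ≤ᵈ m)
  maximal-above {v} v→x
    with extremal {_≼_ = flip _≤ᵈ_} ≤ᵈ-refl (flip ≤ᵈ-trans) (flip _≤ᵈ?_)
                  (successors v) (∈-successors⁺ v→x)
  ... | m , m∈ , x≤m , maxi =
    m , ∈-max⁺ (∈-successors⁻ m∈) (λ u v→u → maxi u (∈-successors⁺ v→u)) , x≤m

  □-match : ∀ {v w} → owner v ≡ □ → owner w ≡ □ → v ≤ᵈ w →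
            ∀ {w′} → w ⟶ w′ → ∃[ v′ ] (v ⟶ v′ × v′ ≤ᵈ w′)
  □-match v□ w□ (R , sim , r) w→w′ with forces-◇-□ w□ (Transfer.odd (sim r) v□) w→w′
  ... | v′ , v→v′ , r′ = v′ , v→v′ , R , sim , r′

  ◇-match : ∀ {v w} → owner v ≡ ◇ → owner w ≡ ◇ → v ≤ᵈ w →
            ∀ {v′} → v ⟶ v′ → ∃[ w′ ] (w ⟶ w′ × v′ ≤ᵈ w′)
  ◇-match v◇ w◇ (R , sim , r) v→v′ with forces-◇-◇ w◇ (Transfer.even (sim r) v◇ _ v→v′)
  ... | w′ , w→w′ , r′ = w′ , w→w′ , R , sim , r′

  min-match : ∀ {v w} → owner v ≡ □ → owner w ≡ □ → v ≡ᵈ w →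
              ∀ {w′} → w′ ∈ min≤ᵈ w → ∃[ v′ ] (v′ ∈ min≤ᵈ v × v′ ≡ᵈ w′)
  min-match v□ w□ (v≤w , w≤v) w′∈ =
    let (w→w′ , w′-min)    = ∈-min⁻ w′∈
        (x , v→x , x≤w′)   = □-match v□ w□ v≤w w→w′
        (v′ , v′∈ , v′≤x)  = minimal-below v→x
        (y , w→y , y≤v′)   = □-match w□ v□ w≤v (proj₁ (∈-min⁻ v′∈))
        v′≤w′              = ≤ᵈ-trans v′≤x x≤w′
    in v′ , v′∈ , v′≤w′ , ≤ᵈ-trans (w′-min y w→y (≤ᵈ-trans y≤v′ v′≤w′)) y≤v′

  max-match : ∀ {v w} → owner v ≡ ◇ → owner w ≡ ◇ → v ≡ᵈ w →
              ∀ {w′} → w′ ∈ max≤ᵈ w → ∃[ v′ ] (v′ ∈ max≤ᵈ v × v′ ≡ᵈ w′)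
  max-match v◇ w◇ (v≤w , w≤v) w′∈ =
    let (w→w′ , w′-max)    = ∈-max⁻ w′∈
        (x , v→x , w′≤x)   = ◇-match w◇ v◇ w≤v w→w′
        (v′ , v′∈ , x≤v′)  = maximal-above v→x
        (y , w→y , v′≤y)   = ◇-match v◇ w◇ v≤w (proj₁ (∈-max⁻ v′∈))
        w′≤v′              = ≤ᵈ-trans w′≤x x≤v′
    in v′ , v′∈ , ≤ᵈ-trans v′≤y (w′-max y w→y (≤ᵈ-trans w′≤v′ v′≤y)) , w′≤v′

  not-□ : ∀ {p} → p ≢ □ → p ≡ ◇
  not-□ {◇} _   = refl
  not-□ {□} neq = contradiction refl neq

  total′ : ∀ C → ∃[ C′ ] C ⟶′ C′
  total′ C with representative C
  ... | w , refl with all□? [ w ]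
  ...   | yes all□ =
    let (_ , w→x)     = total w
        (w′ , w′∈ , _) = minimal-below w→x
    in [ w′ ] , inj₁ (all□ , λ v v∈ →
         let (v′ , v′∈ , eq) = min-match (All.lookup all□ v∈)
                                 (All.lookup all□ (∈-class⁺ ≡ᵈ-refl)) (∈-class⁻ v∈) w′∈
         in v′ , v′∈ , ∈-class⁺ eq)
  ...   | no ¬all□ =
    let (u , u∈ , u≢□) = find (¬All⇒Any¬ (λ v → owner v ≟ₚ □) (members [ w ]) ¬all□)
        (_ , u→x)      = total u
        (u′ , u′∈ , _) = maximal-above u→x
    in [ u′ ] , inj₂ (¬all□ , λ v v∈ v◇ →
         let (v′ , v′∈ , eq) = max-match v◇ (not-□ u≢□)
                                 (≡ᵈ-trans (∈-class⁻ v∈) (swap (∈-class⁻ u∈))) u′∈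
         in v′ , v′∈ , ∈-class⁺ eq)

  quotient : ParityGame
  quotient = record
    { V        = Class
    ; _≟_      = _≟ᶜ_
    ; vertices = classes
    ; complete = classes-complete
    ; _⟶_      = _⟶′_
    ; _⟶?_     = _⟶′?_
    ; total    = total′
    ; Ω        = Ω′
    ; owner    = owner′
    }

open Quotient public using (quotient)

infixr 5 _⊎ᴳ_

_⊎ᴳ_ : ParityGame → ParityGame → ParityGame
G₁ ⊎ᴳ G₂ = record
  { V        = G₁.V ⊎ G₂.V
  ; _≟_      = Sumₚ.≡-dec G₁._≟_ G₂._≟_
  ; vertices = map inj₁ G₁.vertices ++ map inj₂ G₂.vertices
  ; complete = λ where
      (inj₁ v) → ∈-++⁺ˡ (∈-map⁺ inj₁ (G₁.complete v))
      (inj₂ v) → ∈-++⁺ʳ (map inj₁ G₁.vertices) (∈-map⁺ inj₂ (G₂.complete v))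
  ; _⟶_      = Pointwise G₁._⟶_ G₂._⟶_
  ; _⟶?_     = ⊎-decidable G₁._⟶?_ G₂._⟶?_
  ; total    = λ where
      (inj₁ v) → let (w , v→w) = G₁.total v in inj₁ w , inj₁ v→w
      (inj₂ v) → let (w , v→w) = G₂.total v in inj₂ w , inj₂ v→w
  ; Ω        = [ G₁.Ω , G₂.Ω ]′
  ; owner    = [ G₁.owner , G₂.owner ]′
  }
  where
  module G₁ = ParityGame G₁
  module G₂ = ParityGame G₂

GameEquivalent : ∀ {ℓ} → (∀ G → Rel (ParityGame.V G) ℓ) → Rel ParityGame ℓ
GameEquivalent vertexEq G₁ G₂ =
  (∀ v₁ → ∃[ v₂ ] (inj₁ v₁ ∼ inj₂ v₂)) × (∀ v₂ → ∃[ v₁ ] (inj₁ v₁ ∼ inj₂ v₂))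
  where _∼_ = vertexEq (G₁ ⊎ᴳ G₂)

infix 4 _≡ᴳ_

_≡ᴳ_ : Rel ParityGame (lsuc 0ℓ)
_≡ᴳ_ = GameEquivalent Simulation._≡ᵈ_

{-# OPTIONS --safe #-}
-- Write T↑ for the set of classes that meet T.  An upward closed T that every
-- member of a class C can force is forced, as T↑, by C in the quotient: either
-- all members of C belong to □, and every edge of C leads to a minimal, hence
-- T-, successor of each of them, or the maximal successor above a T-successor
-- of a ◇-member yields an edge of C into T↑.  Conversely, the members of C force
-- whatever lies above what C forces.  A □-class with a single class of minimal
-- successors has a single edge, so there its owner is immaterial.
module Submission where

open import Defs
open import Level using (0ℓ)
open import Data.List.Base using (List; []; _∷_; length)
open import Data.List.Extrema.Nat using (argmin-sel)
open import Data.List.Membership.Propositional using (_∈_; find)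
open import Data.List.Membership.Propositional.Properties using (∈-map⁺; ∈-map⁻; ∈-deduplicate⁺)
open import Data.List.Relation.Unary.All using (lookup)
open import Data.List.Relation.Unary.All.Properties using (¬All⇒Any¬)
open import Data.List.Relation.Unary.Any using (here; there)
open import Data.Nat.Base using (_<_; s≤s; z≤n)
import Data.Nat.Properties as ℕₚ
open import Data.Product.Base using (∃-syntax; _×_; _,_; proj₁; proj₂; swap)
open import Data.Sum.Base as Sum using (_⊎_; inj₁; inj₂)
open import Data.Sum.Relation.Binary.Pointwise using (inj₁; inj₂)
open import Function.Base using (id; _∘_)
open import Relation.Binary.Core using (Rel)
open import Relation.Binary.PropositionalEquality using (_≡_; _≢_; refl; sym; trans; subst)
open import Relation.Nullary.Decidable using (yes; no; True; toSum; toWitness; fromWitness)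
open import Relation.Nullary.Negation using (¬_; contradiction)
open import Relation.Unary using (Pred)

-- The membership hypothesis rules out the empty list, on which `minimum` takes the default value
-- zero.
minimum-∈ : ∀ {n ns} → n ∈ ns → minimum ns ∈ ns
minimum-∈ {ns = m ∷ ms} _ with argmin-sel id m ms
... | inj₁ eq = here eq
... | inj₂ m∈ = there m∈

length≯1⇒≡ : ∀ {a} {A : Set a} {xs : List A} {x y} → ¬ (1 < length xs) → x ∈ xs → y ∈ xs → x ≡ y
length≯1⇒≡ {xs = _ ∷ []}    ≯1 (here refl) (here refl) = refl
length≯1⇒≡ {xs = _ ∷ _ ∷ _} ≯1 _ _ = contradiction (s≤s (s≤s z≤n)) ≯1

□⇒≢◇ : ∀ {p} → p ≡ □ → p ≢ ◇
□⇒≢◇ refl ()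

-- Forcing in a disjoint union, whose edges never change sides.

module UnionForcing (G₁ G₂ : ParityGame) where
  module S₁ = Simulation G₁
  module S₂ = Simulation G₂
  open Simulation (G₁ ⊎ᴳ G₂)

  forces-inj₁ : ∀ {T : Pred _ 0ℓ} {v i} → v S₁.⟶[ i ] (T ∘ inj₁) → inj₁ v ⟶[ i ] T
  forces-inj₁ (inj₁ (eq , v′ , v→v′ , t)) = inj₁ (eq , inj₁ v′ , inj₁ v→v′ , t)
  forces-inj₁ (inj₂ (neq , sub))          = inj₂ (neq , λ { (inj₁ v→v′) → sub v→v′ })

  forces-inj₂ : ∀ {T : Pred _ 0ℓ} {v i} → v S₂.⟶[ i ] (T ∘ inj₂) → inj₂ v ⟶[ i ] T
  forces-inj₂ (inj₁ (eq , v′ , v→v′ , t)) = inj₁ (eq , inj₂ v′ , inj₂ v→v′ , t)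
  forces-inj₂ (inj₂ (neq , sub))          = inj₂ (neq , λ { (inj₂ v→v′) → sub v→v′ })

module QuotientForcing (G : ParityGame) where
  open ParityGame G
  open Simulation G
  open Classes G
  open Quotient G hiding (quotient)
  open Simulation (quotient G) using () renaming (_⟶[_]_ to _⟶′[_]_)

  infix 4 _≼_

  -- A small copy of _≤ᵈ_, so that it can occur in a direct simulation.
  _≼_ : Rel V 0ℓ
  v ≼ w = True (v ≤ᵈ? w)

  ≼⇒≤ : ∀ {v w} → v ≼ w → v ≤ᵈ w
  ≼⇒≤ = toWitness

  ≤⇒≼ : ∀ {v w} → v ≤ᵈ w → v ≼ w
  ≤⇒≼ = fromWitness

  ≼-trans : ∀ {u v w} → u ≼ v → v ≼ w → u ≼ w
  ≼-trans u≼v v≼w = ≤⇒≼ (≤ᵈ-trans (≼⇒≤ u≼v) (≼⇒≤ v≼w))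

  -- Any simulation `R` witnessing `v ≼ w` is contained in `_≼_`, so its transfer conditions weaken
  -- to those for `_≼_`.
  ≼-isDirectSimulation : IsDirectSimulation _≼_
  ≼-isDirectSimulation v≼w with ≼⇒≤ v≼w
  ... | R , sim , r = transfer-mono (λ r′ → ≤⇒≼ (R , sim , r′)) (sim r)

  UpwardClosed : Pred V 0ℓ → Set
  UpwardClosed T = ∀ {x y} → T x → x ≼ y → T y

  forces-≼ : ∀ {T : Pred V 0ℓ} {v w} → UpwardClosed T → v ≼ w → v ⟶[ ◇ ] T → w ⟶[ ◇ ] T
  forces-≼ up v≼w f =
    forces-mono (λ (_ , t , x≼y) → up t x≼y) (forces-transfer (≼-isDirectSimulation v≼w) f)

  -- Members, priorities, owners and edges of classes.

  members-≡ᵈ : ∀ {C u v} → u ∈ᶜ C → v ∈ᶜ C → u ≡ᵈ v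
  members-≡ᵈ {C} u∈ v∈ with representative C
  ... | _ , refl = ≡ᵈ-trans (∈-class⁻ u∈) (swap (∈-class⁻ v∈))

  members-≼ : ∀ {C u v} → u ∈ᶜ C → v ∈ᶜ C → u ≼ v
  members-≼ {C} u∈ v∈ = ≤⇒≼ (proj₁ (members-≡ᵈ {C} u∈ v∈))

  inhabited : ∀ C → ∃[ v ] v ∈ᶜ C
  inhabited C with representative C
  ... | v , refl = v , ∈-class⁺ ≡ᵈ-refl

  []-injective : ∀ {u v} → [ u ] ≡ [ v ] → u ≡ᵈ v
  []-injective {u} eq = ∈-class⁻ (subst (u ∈ᶜ_) eq (∈-class⁺ ≡ᵈ-refl))

  -- The minimum is attained at some member, and simulation-equivalent vertices have equal
  -- priorities.
  Ω′-member : ∀ {C v} → v ∈ᶜ C → Ω′ C ≡ Ω v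
  Ω′-member {C} v∈ with ∈-map⁻ Ω (minimum-∈ (∈-map⁺ Ω v∈))
  ... | _ , u∈ , eq =
    trans eq (Transfer.priority (≼-isDirectSimulation (members-≼ {C} u∈ v∈)))

  ◇-member : ∀ {C} → ¬ All□ C → ∃[ v ] (v ∈ᶜ C × owner v ≡ ◇)
  ◇-member {C} ¬all□ with find (¬All⇒Any¬ (λ v → owner v ≟ₚ □) (members C) ¬all□)
  ... | v , v∈ , v≢□ = v , v∈ , not-□ v≢□

  owner′-□ : ∀ {C} → owner′ C ≡ □ → All□ C × Branching C
  owner′-□ {C} eq with all□? C | branching? C
  owner′-□ _  | yes all□ | yes br = all□ , br
  owner′-□ () | yes _    | no _
  owner′-□ () | no _     | _

  owner′-◇ : ∀ {C} → owner′ C ≡ ◇ → All□ C → ¬ Branching C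
  owner′-◇ {C} eq all□ br with all□? C | branching? C
  owner′-◇ () _ _  | yes _    | yes _
  owner′-◇ _ _ br  | yes _    | no ¬br = ¬br br
  owner′-◇ _ all□ _ | no ¬all□ | _     = ¬all□ all□

  -- Equivalent □-vertices have the same classes of minimal successors, so a single member suffices
  -- to produce the edge.
  min-edge : ∀ {C v m} → All□ C → v ∈ᶜ C → m ∈ min≤ᵈ v → C ⟶′ [ m ]
  min-edge {C} all□ v∈ m∈ = inj₁ (all□ , λ u u∈ →
    let (u′ , u′∈ , eq) = min-match (lookup all□ u∈) (lookup all□ v∈) (members-≡ᵈ {C} u∈ v∈) m∈
    in u′ , u′∈ , ∈-class⁺ eq)

  max-edge : ∀ {C v m} → v ∈ᶜ C → owner v ≡ ◇ → m ∈ max≤ᵈ v → C ⟶′ [ m ]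
  max-edge {C} v∈ v◇ m∈ = inj₂ (¬all□ , λ u u∈ u◇ →
    let (u′ , u′∈ , eq) = max-match u◇ v◇ (members-≡ᵈ {C} u∈ v∈) m∈
    in u′ , u′∈ , ∈-class⁺ eq)
    where
    ¬all□ : ¬ All□ C
    ¬all□ all□ = □⇒≢◇ (lookup all□ v∈) v◇

  min-edge⁻ : ∀ {C D v} → All□ C → C ⟶′ D → v ∈ᶜ C → ∃[ v′ ] (v′ ∈ min≤ᵈ v × v′ ∈ᶜ D)
  min-edge⁻ all□ (inj₁ (_ , edge))  v∈ = edge _ v∈
  min-edge⁻ all□ (inj₂ (¬all□ , _)) v∈ = contradiction all□ ¬all□

  max-edge⁻ : ∀ {C D v} → ¬ All□ C → C ⟶′ D → v ∈ᶜ C → owner v ≡ ◇ →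
              ∃[ v′ ] (v′ ∈ max≤ᵈ v × v′ ∈ᶜ D)
  max-edge⁻ ¬all□ (inj₁ (all□ , _)) v∈ v◇ = contradiction all□ ¬all□
  max-edge⁻ ¬all□ (inj₂ (_ , edge)) v∈ v◇ = edge _ v∈ v◇

  -- Forcing carried from members to their class.

  infix 30 _↑

  _↑ : Pred V 0ℓ → Pred Class 0ℓ
  (T ↑) C = ∃[ v ] (v ∈ᶜ C × T v)

  forces-↑ : ∀ {T : Pred V 0ℓ} {C} → UpwardClosed T → (∀ {v} → v ∈ᶜ C → v ⟶[ ◇ ] T) →
             C ⟶′[ ◇ ] (T ↑)
  forces-↑ {T} {C} up f = Sum.[ □-class , ◇-class ]′ (toSum (all□? C))
    where
    edge⇒↑ : All□ C → ∀ {D} → C ⟶′ D → (T ↑) D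
    edge⇒↑ all□ {D} C→D =
      let (v , v∈)        = inhabited C
          (v′ , v′∈ , ∈D) = min-edge⁻ {C} {D} all□ C→D v∈
      in v′ , ∈D , forces-◇-□ (lookup all□ v∈) (f v∈) (proj₁ (∈-min⁻ v′∈))

    □-class : All□ C → C ⟶′[ ◇ ] (T ↑)
    -- Every edge of `C` enters `T ↑`, so either owner forces it; for ◇ an edge is supplied by
    -- totality of the quotient.
    □-class all□ with owner′ C ≟ₚ ◇
    ... | yes eq = let (D , C→D) = total′ C in inj₁ (eq , D , C→D , edge⇒↑ all□ {D} C→D)
    ... | no neq = inj₂ (neq , λ {D} → edge⇒↑ all□ {D})

    ◇-class : ¬ All□ C → C ⟶′[ ◇ ] (T ↑)
    ◇-class ¬all□ =
      let (v , v∈ , v◇)  = ◇-member {C} ¬all□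
          (x , v→x , t)  = forces-◇-◇ v◇ (f v∈)
          (m , m∈ , x≤m) = maximal-above v→x
      in inj₁ (not-□ (λ eq → ¬all□ (proj₁ (owner′-□ {C} eq))) ,
               [ m ] , max-edge {C} v∈ v◇ m∈ , m , ∈-class⁺ ≡ᵈ-refl , up t (≤⇒≼ x≤m))

  -- Forcing carried from a class to its members.

  infix 30 _↓

  _↓ : Pred Class 0ℓ → Pred V 0ℓ
  (U ↓) x = ∃[ D ] (U D × ∃[ v ] (v ∈ᶜ D × v ≼ x))

  -- Some minimal successor lies below `x`; there being only one class of them, it is equivalent to
  -- `m`.
  minimal-least : ∀ {v m x} → ¬ (1 < numberOfClasses (min≤ᵈ v)) → m ∈ min≤ᵈ v → v ⟶ x → m ≼ x
  minimal-least ≯1 m∈ v→x =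
    let (m′ , m′∈ , m′≤x) = minimal-below v→x
        [m]≡[m′]          = length≯1⇒≡ ≯1 (∈-deduplicate⁺ _≟ᶜ_ (∈-map⁺ [_] m∈))
                                          (∈-deduplicate⁺ _≟ᶜ_ (∈-map⁺ [_] m′∈))
    in ≤⇒≼ (≤ᵈ-trans (proj₁ ([]-injective [m]≡[m′])) m′≤x)

  -- Only some member is claimed to force: for a □-class owned by ◇, all that is known is that some
  -- member fails the branching condition. `forces-≼` later passes to the other members.
  forces-above : ∀ {C D} → owner′ C ≡ ◇ → C ⟶′ D →
                 ∃[ v ] (v ∈ᶜ C × v ⟶[ ◇ ] (λ x → ∃[ d ] (d ∈ᶜ D × d ≼ x)))
  forces-above {C} {D} eq C→D = Sum.[ □-class , ◇-class ]′ (toSum (all□? C))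
    where
    □-class : All□ C → ∃[ v ] (v ∈ᶜ C × v ⟶[ ◇ ] (λ x → ∃[ d ] (d ∈ᶜ D × d ≼ x)))
    □-class all□ =
      let (v , v∈ , ≯1) = find (¬All⇒Any¬ (λ u → 1 ℕₚ.<? numberOfClasses (min≤ᵈ u)) (members C)
                                           (owner′-◇ {C} eq all□))
          (d , d∈ , ∈D) = min-edge⁻ {C} {D} all□ C→D v∈
      in v , v∈ , inj₂ (□⇒≢◇ (lookup all□ v∈) , λ v→x → d , ∈D , minimal-least ≯1 d∈ v→x)

    ◇-class : ¬ All□ C → ∃[ v ] (v ∈ᶜ C × v ⟶[ ◇ ] (λ x → ∃[ d ] (d ∈ᶜ D × d ≼ x)))
    ◇-class ¬all□ =
      let (v , v∈ , v◇) = ◇-member {C} ¬all□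
          (d , d∈ , ∈D) = max-edge⁻ {C} {D} ¬all□ C→D v∈ v◇
      in v , v∈ , inj₁ (v◇ , d , proj₁ (∈-max⁻ d∈) , d , ∈D , ≤⇒≼ ≤ᵈ-refl)

  forces-↓ : ∀ {C v} → owner′ C ≡ □ → v ∈ᶜ C → v ⟶[ ◇ ] ((C ⟶′_) ↓)
  forces-↓ {C} eq v∈ =
    let (all□ , _) = owner′-□ {C} eq
    in inj₂ (□⇒≢◇ (lookup all□ v∈) , λ v→x →
         let (m , m∈ , m≤x) = minimal-below v→x
         in [ m ] , min-edge {C} all□ v∈ m∈ , m , ∈-class⁺ ≡ᵈ-refl , ≤⇒≼ m≤x)

  -- Direct simulations in both directions between the quotient and the game.

  open Simulation (quotient G ⊎ᴳ G) using () renaming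
    (_≡ᵈ_ to _≡ᵁ_; IsDirectSimulation to IsDirectSimulationᵁ;
     transfer to transferᵁ)
  open UnionForcing (quotient G) G

  -- Membership alone would be too strict: the vertex answering an edge of the quotient need only
  -- lie above a member of the target class.
  data ClassBelow : Rel (Class ⊎ V) 0ℓ where
    classBelow : ∀ C {v w} → v ∈ᶜ C → v ≼ w → ClassBelow (inj₁ C) (inj₂ w)

  data ClassAbove : Rel (Class ⊎ V) 0ℓ where
    classAbove : ∀ C {v w} → v ∈ᶜ C → w ≼ v → ClassAbove (inj₂ w) (inj₁ C)

  classBelow-isDirectSimulation : IsDirectSimulationᵁ ClassBelow
  classBelow-isDirectSimulation (classBelow C {v} v∈ v≼w) = transferᵁ
    (trans (Ω′-member {C} v∈) (Transfer.priority (≼-isDirectSimulation v≼w)))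
    (λ { eq (inj₁ D) (inj₁ C→D) →
      let (u , u∈ , f) = forces-above {C} {D} eq C→D
      in forces-inj₂ (forces-mono (λ (_ , d∈ , d≼x) → classBelow D d∈ d≼x)
           (forces-≼ (λ (d , d∈ , d≼x) x≼y → d , d∈ , ≼-trans d≼x x≼y)
                     -- The forcing member `u` may differ from `v`, but being equivalent to it is
                     -- also below the simulating vertex.
                     (≼-trans (members-≼ {C} u∈ v∈) v≼w) f)) })
    (λ eq → forces-inj₂ (forces-mono
      (λ (D , C→D , _ , d∈ , d≼x) → inj₁ D , inj₁ C→D , classBelow D d∈ d≼x)
      (forces-≼ (λ (D , C→D , d , d∈ , d≼x) x≼y → D , C→D , d , d∈ , ≼-trans d≼x x≼y)
                v≼w (forces-↓ {C} eq v∈))))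

  classAbove-isDirectSimulation : IsDirectSimulationᵁ ClassAbove
  classAbove-isDirectSimulation (classAbove C {v} {w} v∈ w≼v) = transferᵁ
    (trans (Transfer.priority (≼-isDirectSimulation w≼v)) (sym (Ω′-member {C} v∈)))
    (λ { eq (inj₂ w′) (inj₂ w→w′) → forces-inj₁
      (forces-mono′ {T = (w′ ≼_) ↑} {v = C} (λ {D} (_ , x∈ , w′≼x) → classAbove D x∈ w′≼x)
        (forces-↑ {C = C} ≼-trans λ u∈ →
          Transfer.even (≼-isDirectSimulation (below u∈)) eq w′ w→w′)) })
    (λ eq → forces-inj₁
      (forces-mono′ {T = (w • ⟨ _≼_ ⟩) ↑} {v = C}
        (λ {D} (_ , x∈ , w′ , w→w′ , w′≼x) → inj₂ w′ , inj₂ w→w′ , classAbove D x∈ w′≼x)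
        (forces-↑ {C = C} (λ (w′ , w→w′ , w′≼x) x≼y → w′ , w→w′ , ≼-trans w′≼x x≼y)
          λ u∈ → Transfer.odd (≼-isDirectSimulation (below u∈)) eq)))
    where
    open Simulation (quotient G) using () renaming (forces-mono to forces-mono′)

    -- `forces-↑` asks every member of `C` to force, so `w` must lie below all of them and not just
    -- below `v`.
    below : ∀ {u} → u ∈ᶜ C → w ≼ u
    below u∈ = ≼-trans w≼v (members-≼ {C} v∈ u∈)

  member-≡ᵁ : ∀ {C v} → v ∈ᶜ C → inj₁ C ≡ᵁ inj₂ v
  member-≡ᵁ {C} v∈ =
    (ClassBelow , classBelow-isDirectSimulation , classBelow C v∈ (≤⇒≼ ≤ᵈ-refl)) ,
    (ClassAbove , classAbove-isDirectSimulation , classAbove C v∈ (≤⇒≼ ≤ᵈ-refl))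

theorem12 : (G : ParityGame) → quotient G ≡ᴳ G
theorem12 G =
  (λ C → let (v , v∈) = inhabited C in v , member-≡ᵁ {C} v∈) ,
  (λ v → [ v ] , member-≡ᵁ {[ v ]} (∈-class⁺ ≡ᵈ-refl))
  where
  open Classes G
  open Simulation G
  open QuotientForcing G
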